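{- Let $q$ be a power of $2$ and $k\ge 1$ an integer, and let $S_{2k}=x+x^q+\cdots+x^{q^{2k-1}}\in\mathbb{F}_2[x]$. Let $L\in\mathbb{F}_{q^{3k}}[x]$ be a $2$-linearized polynomial (i.e. $L=\sum_i a_i x^{2^i}$ with $a_i\in\mathbb{F}_{q^{3k}}$) such that (i) $L$ permutes $\mathbb{F}_{q^k}$ (that is, $x\mapsto L(x)$ is a bijection $\mathbb{F}_{q^k}\to\mathbb{F}_{q^k}$), and (ii) $L(x)+L(x)^{q^{2k}}\equiv S_{2k}(x)^4 \pmod{x^{q^{3k}}-x}$. Then $L(x)+S_{2k}(x)^{q^k+3}$ is a permutation polynomial of $\mathbb{F}_{q^{3k}}$.
   Context: $\mathbb{F}_m$ denotes the finite field with $m$ elements. A polynomial $f\in\mathbb{F}_m[x]$ is a permutation polynomial of $\mathbb{F}_m$ if the induced map $x\mapsto f(x)$ is a bijection of $\mathbb{F}_m$. Here $\mathbb{F}_{q^k}\subset\mathbb{F}_{q^{3k}}$ is the subfield of order $q^k$. -}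

module Defs where

open import Algebra.Bundles using (CommutativeRing)
open import Algebra.Bundles.Raw using (RawRing)
import Algebra.Definitions.RawSemiring as RawSemiringDefinitions
open import Data.Fin.Base using (Fin; toℕ)
open import Data.List.Base using (List; []; _∷_; map)
open import Data.Nat.Base as ℕ using (ℕ; zero; suc)
open import Data.Product.Base as Product using (Σ; Σ-syntax; ∃-syntax; _×_; proj₁)
open import Function.Bundles using (Bijection)
open import Function.Definitions using (Bijective)
open import Level using (_⊔_) renaming (suc to lsuc)
open import Relation.Binary.Bundles using (Setoid)
import Relation.Binary.Construct.On as On
open import Relation.Binary.PropositionalEquality as ≡ using (_≡_)
open import Relation.Unary using (Pred)

-- The exponent is positive, so 1 does not count as a power of p.
IsPowerOf : ℕ → ℕ → Set
IsPowerOf p q = ∃[ e ] (1 ℕ.≤ e × q ≡ p ℕ.^ e)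

HasCardinality : ∀ {c ℓ} → Setoid c ℓ → ℕ → Set (c ⊔ ℓ)
HasCardinality S m = Bijection (≡.setoid (Fin m)) S

record Field c ℓ : Set (lsuc (c ⊔ ℓ)) where
  field
    commutativeRing : CommutativeRing c ℓ

  open CommutativeRing commutativeRing public

  field
    0≉1        : 0# ≉ 1#
    invertible : ∀ {x} → x ≉ 0# → ∃[ y ] x * y ≈ 1#

record Subfield {c ℓ} (F : Field c ℓ) p : Set (c ⊔ ℓ ⊔ lsuc p) where
  open Field F
  field
    Member     : Pred Carrier p
    resp       : ∀ {x y} → x ≈ y → Member x → Member y
    0-closed   : Member 0#
    1-closed   : Member 1#
    +-closed   : ∀ {x y} → Member x → Member y → Member (x + y)
    neg-closed : ∀ {x} → Member x → Member (- x)
    *-closed   : ∀ {x y} → Member x → Member y → Member (x * y)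
    inv-closed : ∀ {x y} → Member x → x * y ≈ 1# → Member y

  elements : Setoid (c ⊔ p) ℓ
  elements = On.setoid {B = Σ Carrier Member} setoid proj₁

module Polynomial {c ℓ} (R : CommutativeRing c ℓ) where
  open CommutativeRing R

  infix  4 _≈ₚ_ _≡_[mod_]
  infixl 6 _+ₚ_ _-ₚ_
  infixl 7 _*ₚ_ _·ₚ_
  infix  8 -ₚ_

  -- Coefficient lists, constant term first.  Trailing zeros are allowed;
  -- _≈ₚ_ identifies lists that differ only in them.
  Poly : Set c
  Poly = List Carrier

  coeff : Poly → ℕ → Carrier
  coeff []      n       = 0#
  coeff (a ∷ f) zero    = a
  coeff (a ∷ f) (suc n) = coeff f n

  _≈ₚ_ : Poly → Poly → Set ℓ
  f ≈ₚ g = ∀ n → coeff f n ≈ coeff g n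

  _+ₚ_ : Poly → Poly → Poly
  []      +ₚ g       = g
  (a ∷ f) +ₚ []      = a ∷ f
  (a ∷ f) +ₚ (b ∷ g) = (a + b) ∷ (f +ₚ g)

  -ₚ_ : Poly → Poly
  -ₚ_ = map (-_)

  _-ₚ_ : Poly → Poly → Poly
  f -ₚ g = f +ₚ (-ₚ g)

  _·ₚ_ : Carrier → Poly → Poly
  a ·ₚ f = map (a *_) f

  _*ₚ_ : Poly → Poly → Poly
  []      *ₚ g = []
  (a ∷ f) *ₚ g = (a ·ₚ g) +ₚ (0# ∷ (f *ₚ g))

  X : Poly
  X = 0# ∷ 1# ∷ []

  rawRingₚ : RawRing c ℓ
  rawRingₚ = record
    { Carrier = Poly
    ; _≈_     = _≈ₚ_
    ; _+_     = _+ₚ_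
    ; _*_     = _*ₚ_
    ; -_      = -ₚ_
    ; 0#      = []
    ; 1#      = 1# ∷ []
    }

  open RawSemiringDefinitions (RawRing.rawSemiring rawRingₚ) public
    using () renaming (_^_ to _^ₚ_; sum to sumₚ; _∣_ to _∣ₚ_)

  _≡_[mod_] : Poly → Poly → Poly → Set (c ⊔ ℓ)
  f ≡ g [mod m ] = m ∣ₚ (f -ₚ g)

  eval : Poly → Carrier → Carrier
  eval []      x = 0#
  eval (a ∷ f) x = a + x * eval f x

  IsLinearized : ℕ → Poly → Set (c ⊔ ℓ)
  IsLinearized p f =
    ∃[ n ] Σ[ a ∈ (Fin n → Carrier) ] f ≈ₚ sumₚ (λ i → a i ·ₚ (X ^ₚ (p ℕ.^ toℕ i)))

  -- X + X^q + ⋯ + X^(q^(n-1)); its coefficients are 0 and 1, so it is the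
  -- image in R[X] of the polynomial over the prime field.
  S : (q n : ℕ) → Poly
  S q n = sumₚ {n} (λ i → X ^ₚ (q ℕ.^ toℕ i))

  IsPermutationPolynomial : Poly → Set (c ⊔ ℓ)
  IsPermutationPolynomial f = Bijective _≈_ _≈_ (eval f)

module _ {c ℓ p} {F : Field c ℓ} (K : Subfield F p) where
  open Polynomial (Field.commutativeRing F)
  open Subfield K
  open Setoid elements using () renaming (_≈_ to _≈ᴷ_)

  Permutes : Poly → Set (c ⊔ ℓ ⊔ p)
  Permutes f =
    Σ[ closed ∈ (∀ {x} → Member x → Member (eval f x)) ]
      Bijective _≈ᴷ_ _≈ᴷ_ (Product.map (eval f) closed)

{-# OPTIONS --safe #-}

-- Put Q = q^k and φ x = x^Q, so that φ³ = id on the big field, and let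
-- s = S₂ₖ(x) = y + φ y with y = Sₖ(x); in characteristic 2 the relative trace
-- s + φ s + φ² s vanishes.  For c = L(x) + s^(Q+3), hypothesis (ii) turns
-- c + φ² c into s⁴ + (φ s) s³ + s (φ² s)³ = (φ s) N, where N = s (φ s) (φ² s).
-- The norm of (φ s) N is N⁴, so c determines N, then s, and then L(x).
-- If x and x′ have the same image, d = x + x′ therefore satisfies L(d) = 0 and
-- S₂ₖ(d) = 0.  The latter says that y = Sₖ(d) is fixed by φ, hence so is
-- d + φ d = y + y^q; its relative trace 0 is then three times itself, so
-- φ d = d, d lies in the subfield, and L(d) = 0 forces d = 0.

module Submission where

open import Defs
open import Algebra.Bundles using (CommutativeRing)
open import Algebra.Definitions.RawMagma using (module _∣ʳ_)
import Algebra.Properties.AbelianGroup as AbelianGroupProperties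
import Algebra.Properties.CommutativeMonoid.Sum as MonoidSum
import Algebra.Properties.CommutativeSemiring.Exp as Exponentiation
import Algebra.Properties.Ring as RingProperties
import Algebra.Properties.Semiring.Mult as Multiplication
import Algebra.Properties.Semiring.Sum as SemiringSum
import Algebra.Solver.Ring.NaturalCoefficients.Default as SemiringSolver
open import Data.Fin.Base using (Fin; zero; suc; toℕ; punchIn; punchOut)
open import Data.Fin.Permutation using (Permutation; permutation; _⟨$⟩ʳ_; _⟨$⟩ˡ_; inverseʳ)
import Data.Fin.Properties as Fin
open import Data.List.Base using (List; []; _∷_; length; replicate)
open import Data.List.Properties using (length-replicate)
open import Data.Nat.Base as ℕ using (ℕ; zero; suc; s≤s; z≤n)
import Data.Nat.Properties as ℕ
open import Data.Product.Base using (∃-syntax; _,_; proj₁; proj₂)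
open import Function.Base using (_∘_)
open import Function.Bundles using (Bijection)
open import Function.Definitions using (Injective; Bijective)
open import Relation.Binary.Definitions using (Decidable)
open import Relation.Binary.PropositionalEquality as ≡ using (_≡_; _≢_)
import Relation.Binary.Reasoning.Setoid as SetoidReasoning
open import Relation.Nullary using (¬_; yes; no; contradiction)
import Relation.Nullary.Decidable as Dec

-- Injective self-maps of a finite set.

injective⇒strictlySurjective : ∀ {n} (f : Fin n → Fin n) → Injective _≡_ _≡_ f →
                               ∀ j → ∃[ i ] f i ≡ j
injective⇒strictlySurjective {suc n} f inj j with Fin.any? (λ i → f i Fin.≟ j)
... | yes hit  = hit
-- If `j` were missed, removing it from the codomain with `punchOut` would inject `Fin (suc n)` into
-- `Fin n`.
... | no  miss = contradiction
  (Fin.injective⇒≤ (λ eq → inj (Fin.punchOut-injective (j≢f _) (j≢f _) eq))) ℕ.1+n≰n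
  where
  j≢f : ∀ i → j ≢ f i
  j≢f i j≡fi = miss (i , ≡.sym j≡fi)

injective⇒permutation : ∀ {n} (f : Fin n → Fin n) → Injective _≡_ _≡_ f → Permutation n n
injective⇒permutation f inj = permutation f (proj₁ ∘ hit) (proj₂ ∘ hit) (λ i → inj (proj₂ (hit (f i))))
  where
  hit = injective⇒strictlySurjective f inj

-- Evaluation of coefficient lists as a ring homomorphism.

module Evaluation {c ℓ} (R : CommutativeRing c ℓ) where
  open CommutativeRing R hiding (zero)
  open Polynomial R
  open Exponentiation commutativeSemiring using (_^_; ^-congˡ)
  open SemiringSum semiring using (sum; sum-cong-≋)
  open SemiringSolver commutativeSemiring
  open RingProperties ring using (-0#≈0#; -‿distribʳ-*; -‿+-comm)
  open SetoidReasoning setoid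

  eval-cong : ∀ f {x y} → x ≈ y → eval f x ≈ eval f y
  eval-cong []      x≈y = refl
  eval-cong (a ∷ f) x≈y = +-congˡ (*-cong x≈y (eval-cong f x≈y))

  eval-zero : ∀ f x → (∀ n → coeff f n ≈ 0#) → eval f x ≈ 0#
  eval-zero []      x f≈0 = refl
  eval-zero (a ∷ f) x f≈0 = begin
    a + x * eval f x ≈⟨ +-cong (f≈0 0) (*-congˡ (eval-zero f x (f≈0 ∘ suc))) ⟩
    0# + x * 0#      ≈⟨ trans (+-identityˡ _) (zeroʳ x) ⟩
    0#               ∎

  -- The lists may differ in length; the surplus coefficients are then zero, and `eval-zero` removes
  -- them.
  eval-≈ₚ : ∀ f g x → f ≈ₚ g → eval f x ≈ eval g x
  eval-≈ₚ []      g       x f≈g = sym (eval-zero g x (sym ∘ f≈g))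
  eval-≈ₚ (a ∷ f) []      x f≈g = eval-zero (a ∷ f) x f≈g
  eval-≈ₚ (a ∷ f) (b ∷ g) x f≈g = +-cong (f≈g 0) (*-congˡ (eval-≈ₚ f g x (f≈g ∘ suc)))

  eval-+ₚ : ∀ f g x → eval (f +ₚ g) x ≈ eval f x + eval g x
  eval-+ₚ []      g       x = sym (+-identityˡ _)
  eval-+ₚ (a ∷ f) []      x = sym (+-identityʳ _)
  eval-+ₚ (a ∷ f) (b ∷ g) x = begin
    (a + b) + x * eval (f +ₚ g) x         ≈⟨ +-congˡ (*-congˡ (eval-+ₚ f g x)) ⟩
    (a + b) + x * (eval f x + eval g x)   ≈⟨ solve 5 (λ a b x u v → (a :+ b) :+ x :* (u :+ v) := (a :+ x :* u) :+ (b :+ x :* v)) refl a b x (eval f x) (eval g x) ⟩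
    (a + x * eval f x) + (b + x * eval g x) ∎

  eval-·ₚ : ∀ a f x → eval (a ·ₚ f) x ≈ a * eval f x
  eval-·ₚ a []      x = sym (zeroʳ a)
  eval-·ₚ a (b ∷ f) x = begin
    a * b + x * eval (a ·ₚ f) x ≈⟨ +-congˡ (*-congˡ (eval-·ₚ a f x)) ⟩
    a * b + x * (a * eval f x)  ≈⟨ solve 4 (λ a b x u → a :* b :+ x :* (a :* u) := a :* (b :+ x :* u)) refl a b x (eval f x) ⟩
    a * (b + x * eval f x)      ∎

  eval-negₚ : ∀ f x → eval (-ₚ f) x ≈ - eval f x
  eval-negₚ []      x = sym -0#≈0#
  eval-negₚ (a ∷ f) x = begin
    - a + x * eval (-ₚ f) x ≈⟨ +-congˡ (*-congˡ (eval-negₚ f x)) ⟩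
    - a + x * - eval f x    ≈⟨ +-congˡ (-‿distribʳ-* x (eval f x)) ⟨
    - a + - (x * eval f x)  ≈⟨ -‿+-comm a (x * eval f x) ⟩
    - (a + x * eval f x)    ∎

  eval-minusₚ : ∀ f g x → eval (f -ₚ g) x ≈ eval f x - eval g x
  eval-minusₚ f g x = trans (eval-+ₚ f (-ₚ g) x) (+-congˡ (eval-negₚ g x))

  eval-*ₚ : ∀ f g x → eval (f *ₚ g) x ≈ eval f x * eval g x
  eval-*ₚ []      g x = sym (zeroˡ _)
  eval-*ₚ (a ∷ f) g x = begin
    eval (a ·ₚ g +ₚ (0# ∷ f *ₚ g)) x             ≈⟨ eval-+ₚ (a ·ₚ g) (0# ∷ f *ₚ g) x ⟩
    eval (a ·ₚ g) x + (0# + x * eval (f *ₚ g) x) ≈⟨ +-cong (eval-·ₚ a g x) (trans (+-identityˡ _) (*-congˡ (eval-*ₚ f g x))) ⟩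
    a * eval g x + x * (eval f x * eval g x)     ≈⟨ solve 4 (λ a x u v → a :* v :+ x :* (u :* v) := (a :+ x :* u) :* v) refl a x (eval f x) (eval g x) ⟩
    (a + x * eval f x) * eval g x                ∎

  eval-1 : ∀ x → eval (1# ∷ []) x ≈ 1#
  eval-1 x = trans (+-congˡ (zeroʳ x)) (+-identityʳ 1#)

  eval-X : ∀ x → eval X x ≈ x
  eval-X x = trans (+-identityˡ _) (trans (*-congˡ (eval-1 x)) (*-identityʳ x))

  eval-^ₚ : ∀ f n x → eval (f ^ₚ n) x ≈ eval f x ^ n
  eval-^ₚ f zero    x = eval-1 x
  eval-^ₚ f (suc n) x = trans (eval-*ₚ f (f ^ₚ n) x) (*-congˡ (eval-^ₚ f n x))

  eval-X^ : ∀ n x → eval (X ^ₚ n) x ≈ x ^ n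
  eval-X^ n x = trans (eval-^ₚ X n x) (^-congˡ n (eval-X x))

  eval-sumₚ : ∀ {n} (f : Fin n → Poly) x → eval (sumₚ f) x ≈ sum (λ i → eval (f i) x)
  eval-sumₚ {zero}  f x = refl
  eval-sumₚ {suc n} f x = trans (eval-+ₚ (f zero) _ x) (+-congˡ (eval-sumₚ (f ∘ suc) x))

  eval-S : ∀ q n x → eval (S q n) x ≈ sum {n} (λ i → x ^ (q ℕ.^ toℕ i))
  eval-S q n x = trans
    (eval-sumₚ {n} (λ i → X ^ₚ (q ℕ.^ toℕ i)) x)
    (sum-cong-≋ {n} (λ i → eval-X^ (q ℕ.^ toℕ i) x))

-- Cancellation in a field and the bound on the number of roots.

module FieldProperties {c ℓ} (F : Field c ℓ) where
  open Field F hiding (zero)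
  open Exponentiation commutativeSemiring
  open SemiringSolver commutativeSemiring
  open AbelianGroupProperties +-abelianGroup using (x∙y⁻¹≈ε⇒x≈y) public
  open SetoidReasoning setoid

  *-cancelˡ-≉0 : ∀ {x y z} → x ≉ 0# → x * y ≈ x * z → y ≈ z
  *-cancelˡ-≉0 {x} {y} {z} x≉0 xy≈xz = begin
    y             ≈⟨ unit y ⟨
    x⁻¹ * (x * y) ≈⟨ *-congˡ xy≈xz ⟩
    x⁻¹ * (x * z) ≈⟨ unit z ⟩
    z             ∎
    where
    x⁻¹ = proj₁ (invertible x≉0)
    unit : ∀ w → x⁻¹ * (x * w) ≈ w
    unit w = begin
      x⁻¹ * (x * w) ≈⟨ solve 3 (λ i x w → i :* (x :* w) := (x :* i) :* w) refl x⁻¹ x w ⟩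
      (x * x⁻¹) * w ≈⟨ *-congʳ (proj₂ (invertible x≉0)) ⟩
      1# * w        ≈⟨ *-identityˡ w ⟩
      w             ∎

  xy≈0⇒y≈0 : ∀ {x y} → x ≉ 0# → x * y ≈ 0# → y ≈ 0#
  xy≈0⇒y≈0 {x} x≉0 xy≈0 = *-cancelˡ-≉0 x≉0 (trans xy≈0 (sym (zeroʳ x)))

  -- The monic polynomial of degree length f whose lower coefficients are f.
  monic : List Carrier → Carrier → Carrier
  monic []      x = 1#
  monic (a ∷ f) x = a + x * monic f x

  monic-cong : ∀ f {x y} → x ≈ y → monic f x ≈ monic f y
  monic-cong []      x≈y = refl
  monic-cong (a ∷ f) x≈y = +-congˡ (*-cong x≈y (monic-cong f x≈y))

  -- Synthetic division by X - r of the monic polynomial given by a ∷ f; the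
  -- quotient does not depend on a.
  quotient : Carrier → List Carrier → List Carrier
  quotient r []      = []
  quotient r (b ∷ f) = monic (b ∷ f) r ∷ quotient r f

  length-quotient : ∀ r f → length (quotient r f) ≡ length f
  length-quotient r []      = ≡.refl
  length-quotient r (b ∷ f) = ≡.cong suc (length-quotient r f)

  -- The remainder theorem, with the second point written as `r + d`: no subtraction occurs, so the
  -- semiring solver can verify it.
  monic-quotient : ∀ a f r d →
    monic (a ∷ f) (r + d) ≈ monic (a ∷ f) r + d * monic (quotient r f) (r + d)
  monic-quotient a []      r d =
    solve 3 (λ a r d → a :+ (r :+ d) :* con 1 := (a :+ r :* con 1) :+ d :* con 1) refl a r d
  monic-quotient a (b ∷ f) r d = begin
    a + (r + d) * monic (b ∷ f) (r + d) ≈⟨ +-congˡ (*-congˡ (monic-quotient b f r d)) ⟩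
    a + (r + d) * (m + d * g)           ≈⟨ solve 5 (λ a r d m g → a :+ (r :+ d) :* (m :+ d :* g) := (a :+ r :* m) :+ d :* (m :+ (r :+ d) :* g)) refl a r d m g ⟩
    (a + r * m) + d * (m + (r + d) * g) ∎
    where
    m = monic (b ∷ f) r
    g = monic (quotient r f) (r + d)

  quotient-root : ∀ a f {r x} → r ≉ x → monic (a ∷ f) r ≈ 0# → monic (a ∷ f) x ≈ 0# →
                  monic (quotient r f) x ≈ 0#
  quotient-root a f {r} {x} r≉x fr≈0 fx≈0 = trans (monic-cong (quotient r f) x≈r+d) (xy≈0⇒y≈0 d≉0 (begin
    d * g                 ≈⟨ +-identityˡ _ ⟨
    0# + d * g            ≈⟨ +-congʳ fr≈0 ⟨
    monic (a ∷ f) r + d * g ≈⟨ monic-quotient a f r d ⟨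
    monic (a ∷ f) (r + d) ≈⟨ monic-cong (a ∷ f) x≈r+d ⟨
    monic (a ∷ f) x       ≈⟨ fx≈0 ⟩
    0#                    ∎))
    where
    d = x - r
    g = monic (quotient r f) (r + d)
    d≉0 : d ≉ 0#
    d≉0 d≈0 = r≉x (sym (x∙y⁻¹≈ε⇒x≈y x r d≈0))
    x≈r+d : x ≈ r + d
    x≈r+d = sym (begin
      r + (x - r) ≈⟨ solve 3 (λ r x s → r :+ (x :+ s) := x :+ (r :+ s)) refl r x (- r) ⟩
      x + (r - r) ≈⟨ +-congˡ (-‿inverseʳ r) ⟩
      x + 0#      ≈⟨ +-identityʳ x ⟩
      x           ∎)

  -- Induction on the degree: dividing by the factor of one root leaves a monic polynomial of degree
  -- one less that keeps all other roots. The constant 1 has none.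
  roots≤degree : ∀ {n} f → length f ≡ n → (r : Fin (suc n) → Carrier) → Injective _≡_ _≈_ r →
                 ¬ (∀ i → monic f (r i) ≈ 0#)
  roots≤degree         []      eq     r r-inj root = 0≉1 (sym (root zero))
  roots≤degree {suc n} (a ∷ f) eq     r r-inj root =
    roots≤degree (quotient (r zero) f) (≡.trans (length-quotient (r zero) f) (ℕ.suc-injective eq))
      (r ∘ suc) (Fin.suc-injective ∘ r-inj)
      (λ i → quotient-root a f (λ r₀≈rᵢ → contradiction (r-inj r₀≈rᵢ) Fin.0≢1+n) (root zero) (root (suc i)))

  monic-xⁿ : ∀ n x → monic (replicate n 0#) x ≈ x ^ n
  monic-xⁿ zero    x = refl
  monic-xⁿ (suc n) x = trans (+-identityˡ _) (*-congˡ (monic-xⁿ n x))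

  -- Stands for X^(n+2) - X, the leading coefficient being implicit in monic.
  xⁿ-x : ℕ → List Carrier
  xⁿ-x n = 0# ∷ - 1# ∷ replicate n 0#

  fixed⇒root : ∀ n x → x ^ (2 ℕ.+ n) ≈ x → monic (xⁿ-x n) x ≈ 0#
  fixed⇒root n x xⁿ≈x = begin
    0# + x * (- 1# + x * monic (replicate n 0#) x) ≈⟨ +-identityˡ _ ⟩
    x * (- 1# + x * monic (replicate n 0#) x)      ≈⟨ *-congˡ (+-congˡ (*-congˡ (monic-xⁿ n x))) ⟩
    x * (- 1# + x * x ^ n)                         ≈⟨ distribˡ x (- 1#) (x * x ^ n) ⟩
    x * - 1# + x ^ (2 ℕ.+ n)                       ≈⟨ +-congˡ (trans xⁿ≈x (sym (*-identityʳ x))) ⟩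
    x * - 1# + x * 1#                              ≈⟨ distribˡ x (- 1#) 1# ⟨
    x * (- 1# + 1#)                                ≈⟨ *-congˡ (-‿inverseˡ 1#) ⟩
    x * 0#                                         ≈⟨ zeroʳ x ⟩
    0#                                             ∎

-- Finite enumerations in a field: characteristic and Fermat's identity.

module FiniteField {c ℓ} (F : Field c ℓ) (_≟_ : Decidable (Field._≈_ F)) where
  open Field F hiding (zero)
  open FieldProperties F
  open Exponentiation commutativeSemiring
  open Multiplication semiring using (×1-homo-*) renaming (_×_ to _⋆_)
  open SetoidReasoning setoid
  private
    module Sum = MonoidSum +-commutativeMonoid
    module Prod = MonoidSum *-commutativeMonoid

  Listed : ∀ {m} → (Fin m → Carrier) → Carrier → Set ℓ
  Listed e x = ∃[ i ] e i ≈ x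

  -- An unlisted fixed point would be root number `m + 1` of `X^m - X`, which is monic of degree `m`
  -- because `m` is at least 2.
  fixed⇒listed : ∀ {m} (e : Fin m → Carrier) → Injective _≡_ _≈_ e → 2 ℕ.≤ m →
                 (∀ i → e i ^ m ≈ e i) → ∀ {x} → x ^ m ≈ x → Listed e x
  fixed⇒listed {suc (suc n)} e e-inj (s≤s (s≤s z≤n)) e-fixed {x} x-fixed with Fin.any? (λ i → e i ≟ x)
  ... | yes hit  = hit
  ... | no  miss = contradiction r-root (roots≤degree (xⁿ-x n) (≡.cong (2 ℕ.+_) (length-replicate n)) r r-inj)
    where
    r : Fin (suc (2 ℕ.+ n)) → Carrier
    r zero    = x
    r (suc i) = e i

    r-inj : Injective _≡_ _≈_ r
    r-inj {zero}  {zero}  _  = ≡.refl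
    r-inj {zero}  {suc j} eq = contradiction (j , sym eq) miss
    r-inj {suc i} {zero}  eq = contradiction (i , eq) miss
    r-inj {suc i} {suc j} eq = ≡.cong suc (e-inj eq)

    r-root : ∀ i → monic (xⁿ-x n) (r i) ≈ 0#
    r-root zero    = fixed⇒root n x x-fixed
    r-root (suc i) = fixed⇒root n (e i) (e-fixed i)

  -- An injective map that preserves the listed elements acts injectively on their indices, hence
  -- permutes them. Translations, scalings and finally the polynomial map itself are handled this
  -- way.
  induced : ∀ {m} (e : Fin m → Carrier) → Injective _≡_ _≈_ e →
            (g : Carrier → Carrier) → Injective _≈_ _≈_ g → (∀ i → Listed e (g (e i))) →
            ∃[ π ] (∀ i → e (π ⟨$⟩ʳ i) ≈ g (e i))
  induced e e-inj g g-inj closed = injective⇒permutation σ σ-inj , proj₂ ∘ closed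
    where
    σ = proj₁ ∘ closed
    σ-inj : Injective _≡_ _≡_ σ
    σ-inj {i} {j} eq = e-inj (g-inj (begin
      g (e i) ≈⟨ proj₂ (closed i) ⟨
      e (σ i) ≡⟨ ≡.cong e eq ⟩
      e (σ j) ≈⟨ proj₂ (closed j) ⟩
      g (e j) ∎))

  injective⇒bijective : ∀ {m} (e : Fin m → Carrier) → Injective _≡_ _≈_ e → (∀ x → Listed e x) →
                        (g : Carrier → Carrier) → (∀ {x y} → x ≈ y → g x ≈ g y) →
                        Injective _≈_ _≈_ g → Bijective _≈_ _≈_ g
  injective⇒bijective e e-inj listed g g-cong g-inj = g-inj , surj
    where
    π = proj₁ (induced e e-inj g g-inj (listed ∘ g ∘ e))
    eπ≈ge = proj₂ (induced e e-inj g g-inj (listed ∘ g ∘ e))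
    surj : ∀ y → ∃[ x ] (∀ {z} → z ≈ x → g z ≈ y)
    surj y = e i , λ {z} z≈ei → begin
      g z                 ≈⟨ g-cong z≈ei ⟩
      g (e i)             ≈⟨ eπ≈ge i ⟨
      e (π ⟨$⟩ʳ i)        ≡⟨ ≡.cong e (inverseʳ π) ⟩
      e (proj₁ (listed y)) ≈⟨ proj₂ (listed y) ⟩
      y                   ∎
      where i = π ⟨$⟩ˡ proj₁ (listed y)

  -- Translation by 1 permutes the elements, so their sum absorbs m copies of 1.
  m⋆1≈0 : ∀ {m} (e : Fin m → Carrier) → Injective _≡_ _≈_ e → (∀ x → Listed e x) → m ⋆ 1# ≈ 0#
  m⋆1≈0 {m} e e-inj listed = ∙-cancelˡ (Sum.sum e) _ _ (begin
    Sum.sum e + m ⋆ 1#                   ≈⟨ +-congˡ (Sum.sum-replicate m) ⟨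
    Sum.sum e + Sum.sum {m} (λ _ → 1#)   ≈⟨ Sum.∑-distrib-+ e (λ _ → 1#) ⟨
    Sum.sum (λ i → e i + 1#)             ≈⟨ Sum.sum-cong-≋ eπ≈e+1 ⟨
    Sum.sum (λ i → e (π ⟨$⟩ʳ i))         ≈⟨ Sum.sum-permute e π ⟨
    Sum.sum e                            ≈⟨ +-identityʳ _ ⟨
    Sum.sum e + 0#                       ∎)
    where
    open AbelianGroupProperties +-abelianGroup using (∙-cancelˡ; ∙-cancelʳ)
    translation = induced e e-inj (_+ 1#) (∙-cancelʳ 1# _ _) (λ i → listed (e i + 1#))
    π = proj₁ translation
    eπ≈e+1 = proj₂ translation

  -- If 2 were nonzero, one factor 2 after another could be cancelled, down to 1 = 0.
  2ⁿ⋆1≈0⇒1+1≈0 : ∀ n → (2 ℕ.^ n) ⋆ 1# ≈ 0# → 1# + 1# ≈ 0#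
  2ⁿ⋆1≈0⇒1+1≈0 zero    eq = contradiction (trans (sym eq) (+-identityʳ 1#)) 0≉1
  2ⁿ⋆1≈0⇒1+1≈0 (suc n) eq with (1# + 1#) ≟ 0#
  ... | yes 2≈0 = 2≈0
  ... | no  2≉0 = 2ⁿ⋆1≈0⇒1+1≈0 n (xy≈0⇒y≈0 2≉0 (begin
    (1# + 1#) * (2 ℕ.^ n) ⋆ 1# ≈⟨ *-congʳ (+-congˡ (+-identityʳ 1#)) ⟨
    2 ⋆ 1# * (2 ℕ.^ n) ⋆ 1#    ≈⟨ ×1-homo-* 2 (2 ℕ.^ n) ⟨
    (2 ℕ.* 2 ℕ.^ n) ⋆ 1#       ≈⟨ eq ⟩
    0#                         ∎))

  -- Replacing 0 by 1 lets a product run over all listed elements and still be nonzero, hence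
  -- cancellable.
  unitPart : Carrier → Carrier
  unitPart a with a ≟ 0#
  ... | yes _ = 1#
  ... | no  _ = a

  unitPart-≉0 : ∀ a → unitPart a ≉ 0#
  unitPart-≉0 a with a ≟ 0#
  ... | yes _   = 0≉1 ∘ sym
  ... | no  a≉0 = a≉0

  unitPart-cong : ∀ {a b} → a ≈ b → unitPart a ≈ unitPart b
  unitPart-cong {a} {b} a≈b with a ≟ 0# | b ≟ 0#
  ... | yes _   | yes _   = refl
  ... | yes a≈0 | no  b≉0 = contradiction (trans (sym a≈b) a≈0) b≉0
  ... | no  a≉0 | yes b≈0 = contradiction (trans a≈b b≈0) a≉0
  ... | no  _   | no  _   = a≈b

  -- The correction factor that makes `unitPart` compatible with scaling by `x`.
  atZero : Carrier → Carrier → Carrier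
  atZero x a with a ≟ 0#
  ... | yes _ = x
  ... | no  _ = 1#

  atZero-≈0 : ∀ x {a} → a ≈ 0# → atZero x a ≈ x
  atZero-≈0 x {a} a≈0 with a ≟ 0#
  ... | yes _   = refl
  ... | no  a≉0 = contradiction a≈0 a≉0

  atZero-≉0 : ∀ x {a} → a ≉ 0# → atZero x a ≈ 1#
  atZero-≉0 x {a} a≉0 with a ≟ 0#
  ... | yes a≈0 = contradiction a≈0 a≉0
  ... | no  _   = refl

  -- For nonzero `a` both sides are `x * a`. At zero both unit parts are 1, and `atZero` supplies
  -- the missing `x`.
  unitPart-* : ∀ {x} → x ≉ 0# → ∀ a → atZero x a * unitPart (x * a) ≈ x * unitPart a
  unitPart-* {x} x≉0 a with a ≟ 0# | (x * a) ≟ 0#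
  ... | yes _   | yes _    = refl
  ... | yes a≈0 | no  xa≉0 = contradiction (trans (*-congˡ a≈0) (zeroʳ x)) xa≉0
  ... | no  a≉0 | yes xa≈0 = contradiction (xy≈0⇒y≈0 x≉0 xa≈0) a≉0
  ... | no  _   | no  _    = *-identityˡ _

  prod-≉0 : ∀ {m} (f : Fin m → Carrier) → (∀ i → f i ≉ 0#) → Prod.sum f ≉ 0#
  prod-≉0 {zero}  f f≉0 = 0≉1 ∘ sym
  prod-≉0 {suc m} f f≉0 = prod-≉0 (f ∘ suc) (f≉0 ∘ suc) ∘ xy≈0⇒y≈0 (f≉0 zero)

  -- By injectivity 0 is listed exactly once, so exactly one factor is `x` and the others are 1.
  prod-atZero : ∀ {m} (e : Fin m → Carrier) → Injective _≡_ _≈_ e → Listed e 0# →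
                ∀ x → Prod.sum (atZero x ∘ e) ≈ x
  prod-atZero {suc n} e e-inj (i₀ , e₀≈0) x = begin
    Prod.sum (atZero x ∘ e)                                    ≈⟨ Prod.sum-remove {i = i₀} (atZero x ∘ e) ⟩
    atZero x (e i₀) * Prod.sum (atZero x ∘ e ∘ punchIn i₀)     ≈⟨ *-cong (atZero-≈0 x e₀≈0) (Prod.sum-cong-≋ (λ j → atZero-≉0 x (other j))) ⟩
    x * Prod.sum {n} (λ _ → 1#)                                ≈⟨ *-congˡ (Prod.sum-replicate-zero n) ⟩
    x * 1#                                                     ≈⟨ *-identityʳ x ⟩
    x                                                          ∎
    where
    other : ∀ j → e (punchIn i₀ j) ≉ 0#
    other j eⱼ≈0 = Fin.punchInᵢ≢i i₀ j (e-inj (trans eⱼ≈0 (sym e₀≈0)))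

  -- Multiplication by x permutes the listed elements; comparing the products of
  -- their unit parts gives x * P ≈ x ^ m * P, the factor x on the left making up
  -- for the element 0, whose unit part 1 is not scaled.
  x^m≈x : ∀ {m} (e : Fin m → Carrier) → Injective _≡_ _≈_ e → Listed e 0# →
          ∀ {x} → (∀ i → Listed e (x * e i)) → x ^ m ≈ x
  x^m≈x {m} e e-inj zeroListed {x} closed with x ≟ 0#
  x^m≈x {suc m} e e-inj zeroListed {x} closed | yes x≈0 = begin
    x * x ^ m  ≈⟨ *-congʳ x≈0 ⟩
    0# * x ^ m ≈⟨ zeroˡ _ ⟩
    0#         ≈⟨ x≈0 ⟨
    x          ∎
  x^m≈x {m} e e-inj zeroListed {x} closed | no x≉0 = *-cancelˡ-≉0 (prod-≉0 (unitPart ∘ e) (unitPart-≉0 ∘ e)) (begin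
    P * x ^ m                                                       ≈⟨ *-comm P (x ^ m) ⟩
    x ^ m * P                                                       ≈⟨ *-congʳ (Prod.sum-replicate m) ⟨
    Prod.sum {m} (λ _ → x) * P                                      ≈⟨ Prod.∑-distrib-+ (λ _ → x) (unitPart ∘ e) ⟨
    Prod.sum (λ i → x * unitPart (e i))                             ≈⟨ Prod.sum-cong-≋ (λ i → unitPart-* x≉0 (e i)) ⟨
    Prod.sum (λ i → atZero x (e i) * unitPart (x * e i))            ≈⟨ Prod.∑-distrib-+ (atZero x ∘ e) (λ i → unitPart (x * e i)) ⟩
    Prod.sum (atZero x ∘ e) * Prod.sum (λ i → unitPart (x * e i))   ≈⟨ *-cong (prod-atZero e e-inj zeroListed x) (Prod.sum-cong-≋ (λ i → sym (unitPart-cong (eπ≈xe i)))) ⟩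
    x * Prod.sum (λ i → unitPart (e (π ⟨$⟩ʳ i)))                    ≈⟨ *-congˡ (Prod.sum-permute (unitPart ∘ e) π) ⟨
    x * P                                                           ≈⟨ *-comm x P ⟩
    P * x                                                           ∎)
    where
    P = Prod.sum (unitPart ∘ e)
    scaling = induced e e-inj (x *_) (*-cancelˡ-≉0 x≉0) closed
    π = proj₁ scaling
    eπ≈xe = proj₂ scaling

-- Characteristic 2: additive powers and linearized polynomials.

module Characteristic2 {c ℓ} (F : Field c ℓ) (_≟_ : Decidable (Field._≈_ F))
                       (1+1≈0 : Field._≈_ F (Field._+_ F (Field.1# F) (Field.1# F)) (Field.0# F)) where
  open Field F hiding (zero)
  open FieldProperties F
  open Polynomial commutativeRing
  open Evaluation commutativeRing
  open Exponentiation commutativeSemiring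
  open SemiringSum semiring using (sum; sum-cong-≋; ∑-distrib-+)
  open SemiringSolver commutativeSemiring
  open SetoidReasoning setoid

  x+x≈0 : ∀ x → x + x ≈ 0#
  x+x≈0 x = begin
    x + x           ≈⟨ +-cong (*-identityˡ x) (*-identityˡ x) ⟨
    1# * x + 1# * x ≈⟨ distribʳ x 1# 1# ⟨
    (1# + 1#) * x   ≈⟨ *-congʳ 1+1≈0 ⟩
    0# * x          ≈⟨ zeroˡ x ⟩
    0#              ∎

  -- Every element is its own negative, so `x + y` serves as the difference of `x` and `y`.
  x+y≈0⇒x≈y : ∀ {x y} → x + y ≈ 0# → x ≈ y
  x+y≈0⇒x≈y {x} {y} x+y≈0 = begin
    x           ≈⟨ +-identityʳ x ⟨
    x + 0#      ≈⟨ +-congˡ (x+x≈0 y) ⟨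
    x + (y + y) ≈⟨ +-assoc x y y ⟨
    (x + y) + y ≈⟨ +-congʳ x+y≈0 ⟩
    0# + y      ≈⟨ +-identityˡ y ⟩
    y           ∎

  x≈y⇒x+y≈0 : ∀ {x y} → x ≈ y → x + y ≈ 0#
  x≈y⇒x+y≈0 {x} {y} x≈y = trans (+-congʳ x≈y) (x+x≈0 y)

  -- The cross terms of `(x + y)²` cancel, so `x + y` has square 0.
  x²≈y²⇒x≈y : ∀ {x y} → x * x ≈ y * y → x ≈ y
  x²≈y²⇒x≈y {x} {y} x²≈y² with (x + y) ≟ 0#
  ... | yes x+y≈0 = x+y≈0⇒x≈y x+y≈0
  ... | no  x+y≉0 = x+y≈0⇒x≈y (xy≈0⇒y≈0 x+y≉0 (begin
    (x + y) * (x + y)           ≈⟨ solve 2 (λ x y → (x :+ y) :* (x :+ y) := (x :* x :+ y :* y) :+ (x :* y :+ x :* y)) refl x y ⟩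
    (x * x + y * y) + (x * y + x * y) ≈⟨ +-cong (x≈y⇒x+y≈0 x²≈y²) (x+x≈0 (x * y)) ⟩
    0# + 0#                     ≈⟨ +-identityʳ 0# ⟩
    0#                          ∎))

  IsAdditive : ℕ → Set _
  IsAdditive n = ∀ x y → (x + y) ^ n ≈ x ^ n + y ^ n

  additive-2 : IsAdditive 2
  additive-2 x y = begin
    (x + y) * ((x + y) * 1#)                          ≈⟨ *-congˡ (*-identityʳ _) ⟩
    (x + y) * (x + y)                                 ≈⟨ solve 2 (λ x y → (x :+ y) :* (x :+ y) := (x :* x :+ y :* y) :+ (x :* y :+ x :* y)) refl x y ⟩
    (x * x + y * y) + (x * y + x * y)                 ≈⟨ trans (+-congˡ (x+x≈0 (x * y))) (+-identityʳ _) ⟩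
    x * x + y * y                                     ≈⟨ +-cong (*-congˡ (*-identityʳ x)) (*-congˡ (*-identityʳ y)) ⟨
    x * (x * 1#) + y * (y * 1#)                       ∎

  additive-* : ∀ m n → IsAdditive m → IsAdditive n → IsAdditive (m ℕ.* n)
  additive-* m n add-m add-n x y = begin
    (x + y) ^ (m ℕ.* n)       ≈⟨ ^-assocʳ (x + y) m n ⟨
    ((x + y) ^ m) ^ n         ≈⟨ ^-congˡ n (add-m x y) ⟩
    (x ^ m + y ^ m) ^ n       ≈⟨ add-n (x ^ m) (y ^ m) ⟩
    (x ^ m) ^ n + (y ^ m) ^ n ≈⟨ +-cong (^-assocʳ x m n) (^-assocʳ y m n) ⟩
    x ^ (m ℕ.* n) + y ^ (m ℕ.* n) ∎

  additive-^ : ∀ m → IsAdditive m → ∀ n → IsAdditive (m ℕ.^ n)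
  additive-^ m add zero    x y = distribʳ 1# x y
  additive-^ m add (suc n) = additive-* m (m ℕ.^ n) add (additive-^ m add n)

  -- Additivity rules out `n = 0`, for which the power would be 1.
  0^n≈0 : ∀ n → IsAdditive n → 0# ^ n ≈ 0#
  0^n≈0 n add = begin
    0# ^ n          ≈⟨ ^-congˡ n (+-identityʳ 0#) ⟨
    (0# + 0#) ^ n   ≈⟨ add 0# 0# ⟩
    0# ^ n + 0# ^ n ≈⟨ x+x≈0 (0# ^ n) ⟩
    0#              ∎

  ^-distrib-sum : ∀ n → IsAdditive n → ∀ {m} (f : Fin m → Carrier) → sum f ^ n ≈ sum (λ i → f i ^ n)
  ^-distrib-sum n add {zero}  f = 0^n≈0 n add
  ^-distrib-sum n add {suc m} f = trans (add (f zero) _) (+-congˡ (^-distrib-sum n add (f ∘ suc)))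

  -- All exponents are powers of 2, and these give additive maps.
  linearized-+ : ∀ L → IsLinearized 2 L → ∀ x y → eval L (x + y) ≈ eval L x + eval L y
  linearized-+ L (n , a , L≈) x y = begin
    eval L (x + y)                              ≈⟨ expand (x + y) ⟩
    sum {n} (λ i → a i * (x + y) ^ (2 ℕ.^ toℕ i))   ≈⟨ sum-cong-≋ {n} (λ i → trans (*-congˡ (additive-^ 2 additive-2 (toℕ i) x y)) (distribˡ (a i) _ _)) ⟩
    sum {n} (λ i → a i * x ^ (2 ℕ.^ toℕ i) + a i * y ^ (2 ℕ.^ toℕ i))
                                                ≈⟨ ∑-distrib-+ {n} (λ i → a i * x ^ (2 ℕ.^ toℕ i)) (λ i → a i * y ^ (2 ℕ.^ toℕ i)) ⟩
    sum {n} (λ i → a i * x ^ (2 ℕ.^ toℕ i)) + sum {n} (λ i → a i * y ^ (2 ℕ.^ toℕ i))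
                                                ≈⟨ +-cong (expand x) (expand y) ⟨
    eval L x + eval L y                         ∎
    where
    expand : ∀ x → eval L x ≈ sum {n} (λ i → a i * x ^ (2 ℕ.^ toℕ i))
    expand x = begin
      eval L x                                                   ≈⟨ eval-≈ₚ L (sumₚ {n} (λ i → a i ·ₚ X ^ₚ (2 ℕ.^ toℕ i))) x L≈ ⟩
      eval (sumₚ {n} (λ i → a i ·ₚ X ^ₚ (2 ℕ.^ toℕ i))) x            ≈⟨ eval-sumₚ {n} (λ i → a i ·ₚ X ^ₚ (2 ℕ.^ toℕ i)) x ⟩
      sum {n} (λ i → eval (a i ·ₚ X ^ₚ (2 ℕ.^ toℕ i)) x)             ≈⟨ sum-cong-≋ {n} (λ i → trans (eval-·ₚ (a i) (X ^ₚ (2 ℕ.^ toℕ i)) x) (*-congˡ (eval-X^ (2 ℕ.^ toℕ i) x))) ⟩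
      sum {n} (λ i → a i * x ^ (2 ℕ.^ toℕ i))                        ∎

  -- Trace and norm for a ring endomorphism with trivial cube.

  module CubicFrobenius
    (φ : Carrier → Carrier)
    (φ-cong : ∀ {x y} → x ≈ y → φ x ≈ φ y)
    (φ-+ : ∀ x y → φ (x + y) ≈ φ x + φ y)
    (φ-* : ∀ x y → φ (x * y) ≈ φ x * φ y)
    (φ³≈id : ∀ x → φ (φ (φ x)) ≈ x)
    where

    trace norm : Carrier → Carrier
    trace x = x + (φ x + φ (φ x))
    norm x = x * (φ x * φ (φ x))

    -- Both `x` and `φ x` contribute the same three conjugates, so everything occurs twice.
    trace-x+φx : ∀ x → trace (x + φ x) ≈ 0#
    trace-x+φx x = begin
      (x + φ x) + (φ (x + φ x) + φ (φ (x + φ x)))                  ≈⟨ +-congˡ (+-cong (φ-+ x (φ x)) (trans (φ-cong (φ-+ x (φ x))) (φ-+ (φ x) (φ (φ x))))) ⟩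
      (x + φ x) + ((φ x + φ (φ x)) + (φ (φ x) + φ (φ (φ x))))      ≈⟨ +-congˡ (+-congˡ (+-congˡ (φ³≈id x))) ⟩
      (x + φ x) + ((φ x + φ (φ x)) + (φ (φ x) + x))                ≈⟨ solve 3 (λ a b e → (a :+ b) :+ ((b :+ e) :+ (e :+ a)) := (a :+ (b :+ e)) :+ (a :+ (b :+ e))) refl x (φ x) (φ (φ x)) ⟩
      trace x + trace x                                            ≈⟨ x+x≈0 (trace x) ⟩
      0#                                                           ∎

    -- The trace of a fixed element is three times the element, which in characteristic 2 is the
    -- element itself.
    fixed-traceless⇒0 : ∀ {u} → φ u ≈ u → trace u ≈ 0# → u ≈ 0#
    fixed-traceless⇒0 {u} φu≈u tr≈0 = begin
      u                       ≈⟨ +-identityʳ u ⟨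
      u + 0#                  ≈⟨ +-congˡ (x+x≈0 u) ⟨
      u + (u + u)             ≈⟨ +-congˡ (+-cong φu≈u (trans (φ-cong φu≈u) φu≈u)) ⟨
      u + (φ u + φ (φ u))     ≈⟨ tr≈0 ⟩
      0#                      ∎

    φ-norm : ∀ x → φ (norm x) ≈ norm x
    φ-norm x = begin
      φ (x * (φ x * φ (φ x)))         ≈⟨ trans (φ-* _ _) (*-congˡ (φ-* _ _)) ⟩
      φ x * (φ (φ x) * φ (φ (φ x)))   ≈⟨ *-congˡ (*-congˡ (φ³≈id x)) ⟩
      φ x * (φ (φ x) * x)             ≈⟨ solve 3 (λ a b e → b :* (e :* a) := a :* (b :* e)) refl x (φ x) (φ (φ x)) ⟩
      x * (φ x * φ (φ x))             ∎

    norm-cong : ∀ {x y} → x ≈ y → norm x ≈ norm y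
    norm-cong x≈y = *-cong x≈y (*-cong (φ-cong x≈y) (φ-cong (φ-cong x≈y)))

    φ-0 : φ 0# ≈ 0#
    φ-0 = trans (φ-cong (sym (+-identityʳ 0#))) (trans (φ-+ 0# 0#) (x+x≈0 (φ 0#)))

    φ-injective : ∀ {x y} → φ x ≈ φ y → x ≈ y
    φ-injective {x} {y} eq = trans (sym (φ³≈id x)) (trans (φ-cong (φ-cong eq)) (φ³≈id y))

    φx≈0⇒x≈0 : ∀ {x} → φ x ≈ 0# → x ≈ 0#
    φx≈0⇒x≈0 φx≈0 = φ-injective (trans φx≈0 (sym φ-0))

    norm≈0⇒≈0 : ∀ {x} → norm x ≈ 0# → x ≈ 0#
    norm≈0⇒≈0 {x} N≈0 with x ≟ 0#
    ... | yes x≈0 = x≈0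
    ... | no  x≉0 = φx≈0⇒x≈0 (φx≈0⇒x≈0 (xy≈0⇒y≈0 (x≉0 ∘ φx≈0⇒x≈0) (xy≈0⇒y≈0 x≉0 N≈0)))

    -- The norm is multiplicative: `φ s` has the norm of `s`, and the fixed element `norm s`
    -- contributes its cube.
    norm-φs·norm : ∀ s → norm (φ s * norm s) ≈ (norm s * norm s) * (norm s * norm s)
    norm-φs·norm s = begin
      w * (φ w * φ (φ w))                 ≈⟨ *-congˡ (*-cong φw φφw) ⟩
      (b * n) * ((e * n) * (s * n))       ≈⟨ solve 4 (λ a b e n → (b :* n) :* ((e :* n) :* (a :* n)) := ((a :* (b :* e)) :* n) :* (n :* n)) refl s b e n ⟩
      (n * n) * (n * n)                   ∎
      where
      b = φ s
      e = φ (φ s)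
      n = norm s
      w = b * n
      φw : φ w ≈ e * n
      φw = trans (φ-* b n) (*-congˡ (φ-norm s))
      φφw : φ (φ w) ≈ s * n
      φφw = trans (φ-cong φw) (trans (φ-* e n) (*-cong (φ³≈id s) (φ-norm s)))

    -- Taking norms gives equal fourth powers; two square roots are then extracted.
    φs·norm⇒norm : ∀ {s t} → φ s * norm s ≈ φ t * norm t → norm s ≈ norm t
    φs·norm⇒norm {s} {t} eq =
      x²≈y²⇒x≈y (x²≈y²⇒x≈y (trans (sym (norm-φs·norm s)) (trans (norm-cong eq) (norm-φs·norm t))))

    -- The norms agree, so a nonzero norm cancels and leaves `φ s ≈ φ t`. If the norm is zero, both
    -- elements vanish.
    φs·norm-injective : ∀ {s t} → φ s * norm s ≈ φ t * norm t → s ≈ t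
    φs·norm-injective {s} {t} eq with norm s ≟ 0#
    ... | yes Ns≈0 = trans (norm≈0⇒≈0 Ns≈0) (sym (norm≈0⇒≈0 (trans (sym (φs·norm⇒norm eq)) Ns≈0)))
    ... | no  Ns≉0 = φ-injective (*-cancelˡ-≉0 Ns≉0 (begin
      norm s * φ s ≈⟨ *-comm _ _ ⟩
      φ s * norm s ≈⟨ eq ⟩
      φ t * norm t ≈⟨ *-congˡ (φs·norm⇒norm eq) ⟨
      φ t * norm s ≈⟨ *-comm _ _ ⟩
      norm s * φ t ∎))

    -- Trace zero allows `s + φ s` to be substituted for `φ (φ s)`; what remains is a polynomial
    -- identity in `s` and `φ s` modulo 2.
    traceless-identity : ∀ {s} → trace s ≈ 0# →
      s ^ 4 + (φ s * s ^ 3 + φ (φ (φ s * s ^ 3))) ≈ φ s * norm s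
    traceless-identity {s} tr≈0 = begin
      s ^ 4 + (b * s ^ 3 + φ (φ (b * s ^ 3)))                 ≈⟨ +-congˡ (+-congˡ φφbs³) ⟩
      s ^ 4 + (b * s ^ 3 + s * e ^ 3)                         ≈⟨ +-congˡ (+-congˡ (*-congˡ (^-congˡ 3 e≈s+b))) ⟩
      s ^ 4 + (b * s ^ 3 + s * (s + b) ^ 3)                   ≈⟨ identity ⟩
      b * (s * (b * (s + b))) + (r + r)                       ≈⟨ trans (+-congˡ (x+x≈0 r)) (+-identityʳ _) ⟩
      b * (s * (b * (s + b)))                                 ≈⟨ *-congˡ (*-congˡ (*-congˡ e≈s+b)) ⟨
      b * norm s                                              ∎
      where
      b = φ s
      e = φ (φ s)
      -- Half of the surplus `2s⁴ + 4s³b + 2s²b²` left by expanding over the natural numbers. The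
      -- solver does not reduce modulo 2, so this surplus is displayed as `r + r`.
      r = s * (s * (s * s)) + ((s * (s * (s * b)) + s * (s * (s * b))) + s * (s * (b * b)))

      e≈s+b : e ≈ s + b
      e≈s+b = sym (x+y≈0⇒x≈y (trans (+-assoc s b e) tr≈0))

      φ-cube : ∀ x → φ (x ^ 3) ≈ φ x ^ 3
      φ-cube x = begin
        φ (x * (x * (x * 1#)))  ≈⟨ φ-cong (*-congˡ (*-congˡ (*-identityʳ x))) ⟩
        φ (x * (x * x))         ≈⟨ trans (φ-* _ _) (*-congˡ (φ-* _ _)) ⟩
        φ x * (φ x * φ x)       ≈⟨ *-congˡ (*-congˡ (*-identityʳ (φ x))) ⟨
        φ x ^ 3                 ∎

      φφbs³ : φ (φ (b * s ^ 3)) ≈ s * e ^ 3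
      φφbs³ = begin
        φ (φ (b * s ^ 3))       ≈⟨ φ-cong (trans (φ-* b (s ^ 3)) (*-congˡ (φ-cube s))) ⟩
        φ (e * b ^ 3)           ≈⟨ φ-* e (b ^ 3) ⟩
        φ e * φ (b ^ 3)         ≈⟨ *-cong (φ³≈id s) (φ-cube b) ⟩
        s * e ^ 3               ∎

      identity : s ^ 4 + (b * s ^ 3 + s * (s + b) ^ 3) ≈ b * (s * (b * (s + b))) + (r + r)
      identity = solve 2 (λ s b →
        let r = s :* (s :* (s :* s)) :+ ((s :* (s :* (s :* b)) :+ s :* (s :* (s :* b))) :+ s :* (s :* (b :* b))) in
        s :^ 4 :+ (b :* s :^ 3 :+ s :* (s :+ b) :^ 3) := b :* (s :* (b :* (s :+ b))) :+ (r :+ r)) refl s b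

  -- The maps induced by the polynomials `S q n`.

  module PowerSum (q : ℕ) (q-additive : IsAdditive q) where

    σ : ℕ → Carrier → Carrier
    σ n x = sum {n} (λ i → x ^ (q ℕ.^ toℕ i))

    σ-cong : ∀ n {x y} → x ≈ y → σ n x ≈ σ n y
    σ-cong n x≈y = sum-cong-≋ {n} (λ i → ^-congˡ (q ℕ.^ toℕ i) x≈y)

    σ-suc : ∀ n x → σ (suc n) x ≈ x + σ n (x ^ q)
    σ-suc n x = +-cong (*-identityʳ x) (sum-cong-≋ {n} (λ i → sym (^-assocʳ x q (q ℕ.^ toℕ i))))

    -- From index `m` on, the terms are the iterated `q`-th powers of `x ^ (q ℕ.^ m)`.
    σ-+ : ∀ m n x → σ (m ℕ.+ n) x ≈ σ m x + σ n (x ^ (q ℕ.^ m))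
    σ-+ zero    n x = sym (trans (+-identityˡ _) (σ-cong n (*-identityʳ x)))
    σ-+ (suc m) n x = begin
      σ (suc m ℕ.+ n) x                                ≈⟨ σ-suc (m ℕ.+ n) x ⟩
      x + σ (m ℕ.+ n) (x ^ q)                          ≈⟨ +-congˡ (σ-+ m n (x ^ q)) ⟩
      x + (σ m (x ^ q) + σ n ((x ^ q) ^ (q ℕ.^ m)))    ≈⟨ +-assoc _ _ _ ⟨
      (x + σ m (x ^ q)) + σ n ((x ^ q) ^ (q ℕ.^ m))    ≈⟨ +-cong (sym (σ-suc m x)) (σ-cong n (^-assocʳ x q (q ℕ.^ m))) ⟩
      σ (suc m) x + σ n (x ^ (q ℕ.^ suc m))            ∎

    σ-additive : ∀ n x y → σ n (x + y) ≈ σ n x + σ n y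
    σ-additive n x y = trans (sum-cong-≋ {n} (λ i → additive-^ q q-additive (toℕ i) x y))
                             (∑-distrib-+ {n} (λ i → x ^ (q ℕ.^ toℕ i)) (λ i → y ^ (q ℕ.^ toℕ i)))

    σ-^ : ∀ j → IsAdditive j → ∀ n x → σ n (x ^ j) ≈ σ n x ^ j
    σ-^ j j-additive n x = begin
      sum {n} (λ i → (x ^ j) ^ (q ℕ.^ toℕ i))   ≈⟨ sum-cong-≋ {n} (λ i → swap (q ℕ.^ toℕ i)) ⟩
      sum {n} (λ i → (x ^ (q ℕ.^ toℕ i)) ^ j)   ≈⟨ ^-distrib-sum j j-additive {n} (λ i → x ^ (q ℕ.^ toℕ i)) ⟨
      σ n x ^ j                                 ∎
      where
      swap : ∀ m → (x ^ j) ^ m ≈ (x ^ m) ^ j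
      swap m = trans (^-assocʳ x j m) (trans (^-congʳ x (ℕ.*-comm j m)) (sym (^-assocʳ x m j)))

    -- Splitting off the last term of `σ (suc n) x` and splitting off its first term give two
    -- expressions; their comparison is the claim.
    σ-telescope : ∀ n x → σ n x + σ n x ^ q ≈ x + x ^ (q ℕ.^ n)
    σ-telescope n x = x+y≈0⇒x≈y (begin
      (u + v) + (x + y)            ≈⟨ solve 4 (λ u v x y → (u :+ v) :+ (x :+ y) := (u :+ y) :+ (x :+ v)) refl u v x y ⟩
      (u + y) + (x + v)            ≈⟨ x≈y⇒x+y≈0 (begin
        u + y                        ≈⟨ +-congˡ (trans (+-identityʳ _) (*-identityʳ y)) ⟨
        u + σ 1 y                    ≈⟨ σ-+ n 1 x ⟨
        σ (n ℕ.+ 1) x                ≡⟨ ≡.cong (λ m → σ m x) (ℕ.+-comm n 1) ⟩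
        σ (suc n) x                  ≈⟨ σ-suc n x ⟩
        x + σ n (x ^ q)              ≈⟨ +-congˡ (σ-^ q q-additive n x) ⟩
        x + v                        ∎) ⟩
      0#                           ∎)
      where
      u = σ n x
      v = σ n x ^ q
      y = x ^ (q ℕ.^ n)

    -- The power map with exponent `q ℕ.^ k` and the kernel of `σ (2 ℕ.* k)`.

    module Cubic (k : ℕ) (x^q³ᵏ≈x : ∀ x → x ^ (q ℕ.^ (3 ℕ.* k)) ≈ x) where

      Q : ℕ
      Q = q ℕ.^ k

      Q-additive : IsAdditive Q
      Q-additive = additive-^ q q-additive k

      φ : Carrier → Carrier
      φ x = x ^ Q

      φ-iterate : ∀ n x → φ (x ^ (q ℕ.^ n)) ≈ x ^ (q ℕ.^ (k ℕ.+ n))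
      φ-iterate n x = trans (^-assocʳ x (q ℕ.^ n) Q) (^-congʳ x
        (≡.trans (ℕ.*-comm (q ℕ.^ n) Q) (≡.sym (ℕ.^-distribˡ-+-* q k n))))

      -- `2 ℕ.* k` unfolds to `k ℕ.+ (k ℕ.+ 0)`, so iteration has to start from the exponent
      -- `k ℕ.+ 0`.
      φ-0-iterate : ∀ x → φ x ≈ x ^ (q ℕ.^ (k ℕ.+ 0))
      φ-0-iterate x = ^-congʳ x (≡.cong (q ℕ.^_) (≡.sym (ℕ.+-identityʳ k)))

      φ²≈ : ∀ x → φ (φ x) ≈ x ^ (q ℕ.^ (2 ℕ.* k))
      φ²≈ x = trans (^-congˡ Q (φ-0-iterate x)) (φ-iterate (k ℕ.+ 0) x)

      φ³≈id : ∀ x → φ (φ (φ x)) ≈ x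
      φ³≈id x = trans (^-congˡ Q (φ²≈ x)) (trans (φ-iterate (2 ℕ.* k) x) (x^q³ᵏ≈x x))

      open CubicFrobenius φ (^-congˡ Q) Q-additive (λ x y → ^-distrib-* x y Q) φ³≈id public

      -- The second half of the sum is the first half at `φ x`, and `φ` passes through `σ k`.
      σ₂ₖ≈ : ∀ x → σ (2 ℕ.* k) x ≈ σ k x + φ (σ k x)
      σ₂ₖ≈ x = begin
        σ (2 ℕ.* k) x         ≡⟨ ≡.cong (λ m → σ (k ℕ.+ m) x) (ℕ.+-identityʳ k) ⟩
        σ (k ℕ.+ k) x         ≈⟨ σ-+ k k x ⟩
        σ k x + σ k (φ x)     ≈⟨ +-congˡ (σ-^ Q Q-additive k x) ⟩
        σ k x + φ (σ k x)     ∎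

      trace-cong : ∀ {x y} → x ≈ y → trace x ≈ trace y
      trace-cong x≈y = +-cong x≈y (+-cong (^-congˡ Q x≈y) (^-congˡ Q (^-congˡ Q x≈y)))

      trace-σ₂ₖ : ∀ x → trace (σ (2 ℕ.* k) x) ≈ 0#
      trace-σ₂ₖ x = trans (trace-cong (σ₂ₖ≈ x)) (trace-x+φx (σ k x))

      -- For `y = σ k d`, telescoping turns `d + φ d` into `y + y ^ q`, which `φ` fixes because it
      -- fixes `y`. Being traceless too, `d + φ d` vanishes.
      σ₂ₖ≈0⇒fixed : ∀ {d} → σ (2 ℕ.* k) d ≈ 0# → φ d ≈ d
      σ₂ₖ≈0⇒fixed {d} σ≈0 = sym (x+y≈0⇒x≈y (fixed-traceless⇒0 (begin
        φ (d + φ d)                ≈⟨ ^-congˡ Q (σ-telescope k d) ⟨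
        φ (y + y ^ q)              ≈⟨ Q-additive y (y ^ q) ⟩
        φ y + φ (y ^ q)            ≈⟨ +-cong φy≈y φyq≈yq ⟩
        y + y ^ q                  ≈⟨ σ-telescope k d ⟩
        d + φ d                    ∎) (trace-x+φx d)))
        where
        y = σ k d
        φy≈y : φ y ≈ y
        φy≈y = sym (x+y≈0⇒x≈y (trans (sym (σ₂ₖ≈ d)) σ≈0))
        φyq≈yq : φ (y ^ q) ≈ y ^ q
        φyq≈yq = begin
          (y ^ q) ^ Q   ≈⟨ ^-assocʳ y q Q ⟩
          y ^ (q ℕ.* Q) ≈⟨ ^-congʳ y (ℕ.*-comm q Q) ⟩
          y ^ (Q ℕ.* q) ≈⟨ ^-assocʳ y Q q ⟨
          (y ^ Q) ^ q   ≈⟨ ^-congˡ q φy≈y ⟩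
          y ^ q         ∎

      -- Injectivity of the polynomial map.

      module _ (L : Poly) (linearized : IsLinearized 2 L)
               (L-kernel : ∀ {d} → φ d ≈ d → eval L d ≈ 0# → d ≈ 0#)
               (congruence : (L +ₚ L ^ₚ (q ℕ.^ (2 ℕ.* k))) ≡ (S q (2 ℕ.* k) ^ₚ 4)
                               [mod X ^ₚ (q ℕ.^ (3 ℕ.* k)) -ₚ X ]) where

        private
          f : Poly
          f = L +ₚ S q (2 ℕ.* k) ^ₚ (q ℕ.^ k ℕ.+ 3)

          s : Carrier → Carrier
          s = σ (2 ℕ.* k)

        -- The modulus vanishes at every element of the field, so the congruence becomes an equality
        -- of values.
        L+φ²L≈s⁴ : ∀ x → eval L x + φ (φ (eval L x)) ≈ s x ^ 4
        L+φ²L≈s⁴ x = begin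
          eval L x + φ (φ (eval L x))                    ≈⟨ +-congˡ (φ²≈ (eval L x)) ⟩
          eval L x + eval L x ^ (q ℕ.^ (2 ℕ.* k))        ≈⟨ +-congˡ (eval-^ₚ L (q ℕ.^ (2 ℕ.* k)) x) ⟨
          eval L x + eval (L ^ₚ (q ℕ.^ (2 ℕ.* k))) x     ≈⟨ eval-+ₚ L (L ^ₚ (q ℕ.^ (2 ℕ.* k))) x ⟨
          eval lhs x                                     ≈⟨ x∙y⁻¹≈ε⇒x≈y _ _ difference≈0 ⟩
          eval (S q (2 ℕ.* k) ^ₚ 4) x                    ≈⟨ eval-^ₚ (S q (2 ℕ.* k)) 4 x ⟩
          eval (S q (2 ℕ.* k)) x ^ 4                     ≈⟨ ^-congˡ 4 (eval-S q (2 ℕ.* k) x) ⟩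
          s x ^ 4                                        ∎
          where
          lhs = L +ₚ L ^ₚ (q ℕ.^ (2 ℕ.* k))
          rhs = S q (2 ℕ.* k) ^ₚ 4
          modulus = X ^ₚ (q ℕ.^ (3 ℕ.* k)) -ₚ X
          h = _∣ʳ_.quotient congruence

          modulus≈0 : eval modulus x ≈ 0#
          modulus≈0 = begin
            eval modulus x                                ≈⟨ eval-minusₚ (X ^ₚ (q ℕ.^ (3 ℕ.* k))) X x ⟩
            eval (X ^ₚ (q ℕ.^ (3 ℕ.* k))) x - eval X x    ≈⟨ +-cong (trans (eval-X^ (q ℕ.^ (3 ℕ.* k)) x) (x^q³ᵏ≈x x)) (-‿cong (eval-X x)) ⟩
            x - x                                         ≈⟨ -‿inverseʳ x ⟩
            0#                                            ∎

          difference≈0 : eval lhs x - eval rhs x ≈ 0#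
          difference≈0 = begin
            eval lhs x - eval rhs x     ≈⟨ eval-minusₚ lhs rhs x ⟨
            eval (lhs -ₚ rhs) x         ≈⟨ eval-≈ₚ (h *ₚ modulus) (lhs -ₚ rhs) x (_∣ʳ_.equality congruence) ⟨
            eval (h *ₚ modulus) x       ≈⟨ eval-*ₚ h modulus x ⟩
            eval h x * eval modulus x   ≈⟨ *-congˡ modulus≈0 ⟩
            eval h x * 0#               ≈⟨ zeroʳ _ ⟩
            0#                          ∎

        eval-f : ∀ x → eval f x ≈ eval L x + φ (s x) * s x ^ 3
        eval-f x = begin
          eval f x                                              ≈⟨ eval-+ₚ L (S q (2 ℕ.* k) ^ₚ (Q ℕ.+ 3)) x ⟩
          eval L x + eval (S q (2 ℕ.* k) ^ₚ (Q ℕ.+ 3)) x        ≈⟨ +-congˡ (eval-^ₚ (S q (2 ℕ.* k)) (Q ℕ.+ 3) x) ⟩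
          eval L x + eval (S q (2 ℕ.* k)) x ^ (Q ℕ.+ 3)         ≈⟨ +-congˡ (^-congˡ (Q ℕ.+ 3) (eval-S q (2 ℕ.* k) x)) ⟩
          eval L x + s x ^ (Q ℕ.+ 3)                            ≈⟨ +-congˡ (^-homo-* (s x) Q 3) ⟩
          eval L x + φ (s x) * s x ^ 3                          ∎

        -- Adding the image under `φ²` eliminates `L`, leaving an expression in `s x` alone.
        f+φ²f : ∀ x → eval f x + φ (φ (eval f x)) ≈ φ (s x) * norm (s x)
        f+φ²f x = begin
          eval f x + φ (φ (eval f x))                     ≈⟨ +-cong (eval-f x) (^-congˡ Q (^-congˡ Q (eval-f x))) ⟩
          (l + w) + φ (φ (l + w))                         ≈⟨ +-congˡ (trans (^-congˡ Q (Q-additive l w)) (Q-additive (φ l) (φ w))) ⟩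
          (l + w) + (φ (φ l) + φ (φ w))                   ≈⟨ solve 4 (λ l w m v → (l :+ w) :+ (m :+ v) := (l :+ m) :+ (w :+ v)) refl l w (φ (φ l)) (φ (φ w)) ⟩
          (l + φ (φ l)) + (w + φ (φ w))                   ≈⟨ +-congʳ (L+φ²L≈s⁴ x) ⟩
          s x ^ 4 + (w + φ (φ w))                         ≈⟨ traceless-identity (trace-σ₂ₖ x) ⟩
          φ (s x) * norm (s x)                            ∎
          where
          l = eval L x
          w = φ (s x) * s x ^ 3

        -- Equal values force equal `s`, then equal `L`; by additivity `x + y` lies in both kernels.
        f-injective : Injective _≈_ _≈_ (eval f)
        f-injective {x} {y} fx≈fy = x+y≈0⇒x≈y (L-kernel
          (σ₂ₖ≈0⇒fixed (trans (σ-additive (2 ℕ.* k) x y) (x≈y⇒x+y≈0 sx≈sy)))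
          (trans (linearized-+ L linearized x y) (x≈y⇒x+y≈0 Lx≈Ly)))
          where
          open AbelianGroupProperties +-abelianGroup using (∙-cancelʳ)
          sx≈sy : s x ≈ s y
          sx≈sy = φs·norm-injective (begin
            φ (s x) * norm (s x)          ≈⟨ f+φ²f x ⟨
            eval f x + φ (φ (eval f x))   ≈⟨ +-cong fx≈fy (^-congˡ Q (^-congˡ Q fx≈fy)) ⟩
            eval f y + φ (φ (eval f y))   ≈⟨ f+φ²f y ⟩
            φ (s y) * norm (s y)          ∎)
          Lx≈Ly : eval L x ≈ eval L y
          Lx≈Ly = ∙-cancelʳ (φ (s x) * s x ^ 3) _ _ (begin
            eval L x + φ (s x) * s x ^ 3  ≈⟨ eval-f x ⟨
            eval f x                      ≈⟨ fx≈fy ⟩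
            eval f y                      ≈⟨ eval-f y ⟩
            eval L y + φ (s y) * s y ^ 3  ≈⟨ +-congˡ (*-cong (^-congˡ Q sx≈sy) (^-congˡ 3 sx≈sy)) ⟨
            eval L y + φ (s x) * s x ^ 3  ∎)

-- Instantiation at the given field and subfield.

open import Data.Nat.Base using (ℕ; _+_; _*_; _^_; _≤_)

theorem3p1 : ∀ {c ℓ p} (q k : ℕ) → IsPowerOf 2 q → 1 ≤ k →
    (F : Field c ℓ) → HasCardinality (Field.setoid F) (q ^ (3 * k)) →
    (K : Subfield F p) → HasCardinality (Subfield.elements K) (q ^ k) →
    let open Polynomial (Field.commutativeRing F) in
    (L : Poly) → IsLinearized 2 L →
    Permutes K L →
    (L +ₚ L ^ₚ (q ^ (2 * k))) ≡ (S q (2 * k) ^ₚ 4) [mod X ^ₚ (q ^ (3 * k)) -ₚ X ] →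
    IsPermutationPolynomial (L +ₚ S q (2 * k) ^ₚ (q ^ k + 3))
theorem3p1 q k (n , 1≤n , ≡.refl) 1≤k F F-card K K-card L linearized (closed , L-inj , _) congruence =
  injective⇒bijective e e-inj listed (eval (L +ₚ S q (2 * k) ^ₚ (q ^ k + 3)))
    (eval-cong (L +ₚ S q (2 * k) ^ₚ (q ^ k + 3)))
    (f-injective L linearized L-kernel congruence)
  where
  open Field F using (Carrier; _≈_; 0#; 1#; commutativeRing; sym; trans)
    renaming (_+_ to _+ᶠ_; _*_ to _*ᶠ_)
  open Subfield K using (Member; resp; 0-closed; *-closed)
  open Polynomial commutativeRing
  open Evaluation commutativeRing using (eval-cong)

  module E = Bijection F-card

  e : Fin (q ^ (3 * k)) → Carrier
  e = E.to
  e-inj : Injective _≡_ _≈_ e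
  e-inj = E.injective
  listed : ∀ x → ∃[ i ] e i ≈ x
  listed x = proj₁ (E.surjective x) , proj₂ (E.surjective x) ≡.refl

  -- Equality is decided by comparing indices in the enumeration.
  _≟_ : Decidable _≈_
  x ≟ y = Dec.map′
    (λ eq → trans (sym (proj₂ (listed x))) (trans (Field.reflexive F (≡.cong e eq)) (proj₂ (listed y))))
    (λ x≈y → e-inj (trans (proj₂ (listed x)) (trans x≈y (sym (proj₂ (listed y))))))
    (proj₁ (listed x) Fin.≟ proj₁ (listed y))

  open FiniteField F _≟_

  1+1≈0 : 1# +ᶠ 1# ≈ 0#
  -- The order `q ^ (3 * k)` of the field is `2 ^ (n * (3 * k))`.
  1+1≈0 = 2ⁿ⋆1≈0⇒1+1≈0 (n * (3 * k))
    (trans (Field.reflexive F (≡.cong (λ m → m ⋆ 1#) (≡.sym (ℕ.^-*-assoc 2 n (3 * k))))) (m⋆1≈0 e e-inj listed))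
    where
    open Multiplication (Field.semiring F) using () renaming (_×_ to _⋆_)

  open Characteristic2 F _≟_ 1+1≈0
  open PowerSum q (additive-^ 2 additive-2 n)
  -- Fermat's identity for the whole field, where every product is listed.
  open Cubic k (λ x → x^m≈x e e-inj (listed 0#) (λ i → listed (x *ᶠ e i)))

  module Eᴷ = Bijection K-card

  eᴷ : Fin (q ^ k) → Carrier
  eᴷ = proj₁ ∘ Eᴷ.to
  eᴷ-inj : Injective _≡_ _≈_ eᴷ
  eᴷ-inj = Eᴷ.injective
  listedᴷ : ∀ {x} → Member x → ∃[ i ] eᴷ i ≈ x
  listedᴷ x∈K = proj₁ (Eᴷ.surjective (_ , x∈K)) , proj₂ (Eᴷ.surjective (_ , x∈K)) ≡.refl

  2≤Q : 2 ≤ q ^ k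
  2≤Q = ≡.subst (2 ≤_) (≡.sym (ℕ.^-*-assoc 2 n k)) (ℕ.^-monoʳ-≤ 2 (ℕ.*-mono-≤ 1≤n 1≤k))

  -- The `q ^ k` elements of `K` already exhaust the possible roots of `X^Q - X`, where `Q` is
  -- `q ^ k`.
  fixed⇒member : ∀ {d} → φ d ≈ d → Member d
  fixed⇒member φd≈d = resp (proj₂ hit) (proj₂ (Eᴷ.to (proj₁ hit)))
    where
    hit = fixed⇒listed eᴷ eᴷ-inj 2≤Q
      (λ i → x^m≈x eᴷ eᴷ-inj (listedᴷ 0-closed) (λ j → listedᴷ (*-closed (proj₂ (Eᴷ.to i)) (proj₂ (Eᴷ.to j)))))
      φd≈d

  -- Fixed points lie in `K`, where `L` is injective, so `d` can be compared with 0.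
  L-kernel : ∀ {d} → φ d ≈ d → eval L d ≈ 0# → d ≈ 0#
  L-kernel φd≈d Ld≈0 = L-inj {_ , fixed⇒member φd≈d} {0# , 0-closed} (trans Ld≈0 (sym L0≈0))
    where
    L0≈0 : eval L 0# ≈ 0#
    L0≈0 = trans (eval-cong L (sym (Field.+-identityʳ F 0#))) (trans (linearized-+ L linearized 0# 0#) (x+x≈0 (eval L 0#)))
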